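{- For every integer $n>7$, $F_n\ge 3$.
   Context: Define maps $G,S:\mathbb Z^2\to\mathbb Z^2$ by $G(x,y)=(x+y,y)$ and $S(x,y)=(3x-2y+1,\,2x-y+1)$. Define the array $(F_{n,k})_{n,k\ge 0}$ by $F_{0,0}=1$ and, for $(n,k)\neq(0,0)$, $F_{n,k}$ is the number of finite words $w=w_1w_2\cdots w_m$ ($m\ge 0$) over the alphabet $\{G,S\}$ with $w_1\circ w_2\circ\cdots\circ w_m(1,1)=(n,k)$ (the empty word acts as the identity). Equivalently: start with all entries $0$, set $F_{0,0}=1$ and $F_{1,1}=1$, and thereafter, whenever an entry $F_{n,k}$ with $n\ge 1$ changes its value, increase $F_{n+k,k}$ and $F_{3n+1-2k,\,2n+1-k}$ by $1$. Set $F_n=\sum_{k\ge0}F_{n,k}$ (a finite sum since $F_{n,k}=0$ for $k>n$). -}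

module Defs where

open import Data.Empty using (⊥-elim)
open import Data.Fin using (Fin; zero; suc)
open import Data.Integer as ℤ using (ℤ; +_)
import Data.Integer.Properties as ℤ
open import Data.Integer.Tactic.RingSolver using (solve-∀)
open import Data.List using (List; []; _∷_; _++_; map; filter; length; lookup; foldr; upTo)
open import Data.List.Membership.Propositional using (_∈_)
open import Data.List.Membership.Propositional.Properties
  using (∈-map⁺; ∈-map⁻; ∈-++⁺ˡ; ∈-++⁺ʳ; ∈-filter⁺; ∈-filter⁻; ∈-lookup)
open import Data.List.Properties using (∷-injectiveʳ)
open import Data.List.Relation.Unary.All as All using (All)
import Data.List.Relation.Unary.All.Properties as All
open import Data.List.Relation.Unary.AllPairs using ([]; _∷_)
open import Data.List.Relation.Unary.Any using (here; there; index)
open import Data.List.Relation.Unary.Any.Properties using (lookup-index)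
open import Data.List.Relation.Unary.Unique.Propositional using (Unique)
import Data.List.Relation.Unary.Unique.Propositional.Properties as Unique
open import Data.Nat using (ℕ; zero; suc; _+_; _≤_; _<_; _>_; z≤n; s≤s)
open import Data.Nat.ListAction using (sum)
import Data.Nat.Properties as ℕ
open import Data.Product using (Σ; ∃₂; _×_; _,_; proj₁; proj₂)
open import Data.Product.Properties using (≡-dec)
open import Function using (_↔_; mk↔ₛ′; module Inverse)
open import Relation.Binary.Definitions using (DecidableEquality)
open import Relation.Binary.PropositionalEquality
open import Relation.Nullary using (¬_)
open import Axiom.UniquenessOfIdentityProofs using (module Decidable⇒UIP)

data Letter : Set where
  G S : Letter

Word : Set
Word = List Letter

⟦_⟧ : Letter → ℤ × ℤ → ℤ × ℤ
⟦ G ⟧ (x , y) = x ℤ.+ y , y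
⟦ S ⟧ (x , y) = + 3 ℤ.* x ℤ.- + 2 ℤ.* y ℤ.+ + 1 , + 2 ℤ.* x ℤ.- y ℤ.+ + 1

-- The first letter of a word is the outermost map.
eval : Word → ℤ × ℤ
eval = foldr ⟦_⟧ (+ 1 , + 1)

Reaches : ℕ → ℕ → Word → Set
Reaches n k w = eval w ≡ (+ n , + k)

_≟²_ : DecidableEquality (ℤ × ℤ)
_≟²_ = ≡-dec ℤ._≟_ ℤ._≟_

-- Every word of length less than the argument, each exactly once.
words : ℕ → List Word
words zero    = []
words (suc m) = [] ∷ map (G ∷_) (words m) ++ map (S ∷_) (words m)

-- A word reaching (n , k) has length less than n, so these are all of them.
wordsTo : ℕ → ℕ → List Word
wordsTo n k = filter (λ w → eval w ≟² (+ n , + k)) (words n)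

-- F₂ n k is the array entry F_{n,k}; see F₂-counts.
F₂ : ℕ → ℕ → ℕ
F₂ zero zero = 1
F₂ n    k    = length (wordsTo n k)

-- The sum may stop at k = n by F₂-vanishes.
F : ℕ → ℕ
F n = sum (map (F₂ n) (upTo (suc n)))

eval-shape : ∀ w → ∃₂ λ b d → eval w ≡ (+ (suc b + d) , + suc b) × length w ≤ b + d
eval-shape [] = 0 , 0 , refl , z≤n
eval-shape (G ∷ w) with eval w | eval-shape w
... | _ | b , d , refl , l =
  b , suc b + d , cong (λ z → + z , + suc b) (ℕ.+-comm (suc b + d) (suc b)) ,
  ℕ.≤-trans (s≤s l) (ℕ.m≤n+m (suc b + d) b)
eval-shape (S ∷ w) with eval w | eval-shape w
... | _ | b , d , refl , l =
  b + d + d + 1 , d , cong₂ _,_ (eq₁ (+ suc b) (+ d)) (eq₂ (+ suc b) (+ d)) ,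
  ℕ.≤-trans (s≤s l)
    (ℕ.≤-trans (ℕ.≤-reflexive (ℕ.+-comm 1 (b + d)))
      (ℕ.≤-trans (ℕ.+-monoˡ-≤ 1 (ℕ.m≤m+n (b + d) d)) (ℕ.m≤m+n _ d)))
  where
  eq₁ : ∀ y e → + 3 ℤ.* (y ℤ.+ e) ℤ.- + 2 ℤ.* y ℤ.+ + 1 ≡ y ℤ.+ e ℤ.+ e ℤ.+ + 1 ℤ.+ e
  eq₁ = solve-∀
  eq₂ : ∀ y e → + 2 ℤ.* (y ℤ.+ e) ℤ.- y ℤ.+ + 1 ≡ y ℤ.+ e ℤ.+ e ℤ.+ + 1
  eq₂ = solve-∀

reaches-bounds : ∀ {n k} w → Reaches n k w → length w < n × k ≤ n
reaches-bounds w r with eval w | eval-shape w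
reaches-bounds w refl | _ | b , d , refl , l = s≤s l , ℕ.m≤m+n (suc b) d

words-complete : ∀ {m} w → length w < m → w ∈ words m
words-complete []      (s≤s _) = here refl
words-complete (G ∷ w) (s≤s l) = there (∈-++⁺ˡ (∈-map⁺ (G ∷_) (words-complete w l)))
words-complete {suc m} (S ∷ w) (s≤s l) =
  there (∈-++⁺ʳ (map (G ∷_) (words m)) (∈-map⁺ (S ∷_) (words-complete w l)))

words-unique : ∀ m → Unique (words m)
words-unique zero    = []
words-unique (suc m) =
  All.++⁺ (fresh G (words m)) (fresh S (words m)) ∷
  Unique.++⁺ (Unique.map⁺ ∷-injectiveʳ (words-unique m))
             (Unique.map⁺ ∷-injectiveʳ (words-unique m)) disjoint
  where
  fresh : ∀ l ws → All (λ w → ¬ [] ≡ w) (map (l ∷_) ws)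
  fresh l ws = All.map⁺ (All.universal (λ _ ()) ws)

  disjoint : ∀ {w} → ¬ (w ∈ map (G ∷_) (words m) × w ∈ map (S ∷_) (words m))
  disjoint (p , q) with ∈-map⁻ (G ∷_) p | ∈-map⁻ (S ∷_) q
  ... | _ , _ , refl | _ , _ , ()

lookup-injective : ∀ {A : Set} {xs : List A} → Unique xs →
                   ∀ i j → lookup xs i ≡ lookup xs j → i ≡ j
lookup-injective (_ ∷ _)  zero    zero    _  = refl
lookup-injective (x ∷ _)  zero    (suc j) eq = ⊥-elim (All.lookup x (∈-lookup j) eq)
lookup-injective (x ∷ _)  (suc i) zero    eq = ⊥-elim (All.lookup x (∈-lookup i) (sym eq))
lookup-injective (_ ∷ xs) (suc i) (suc j) eq = cong suc (lookup-injective xs i j eq)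

wordsTo-counts : ∀ n k → Fin (length (wordsTo n k)) ↔ Σ Word (Reaches n k)
wordsTo-counts n k = mk↔ₛ′ to from to∘from from∘to
  where
  P? = λ w → eval w ≟² (+ n , + k)

  to : Fin (length (wordsTo n k)) → Σ Word (Reaches n k)
  to i = lookup (wordsTo n k) i , proj₂ (∈-filter⁻ P? {xs = words n} (∈-lookup i))

  mem : ((w , _) : Σ Word (Reaches n k)) → w ∈ wordsTo n k
  mem (w , r) = ∈-filter⁺ P? (words-complete w (proj₁ (reaches-bounds w r))) r

  from : Σ Word (Reaches n k) → Fin (length (wordsTo n k))
  from p = index (mem p)

  Σ-≡ : ∀ {p q : Σ Word (Reaches n k)} → proj₁ p ≡ proj₁ q → p ≡ q
  Σ-≡ {w , r} {_ , s} refl = cong (w ,_) (Decidable⇒UIP.≡-irrelevant _≟²_ r s)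

  to∘from : ∀ p → to (from p) ≡ p
  to∘from p = Σ-≡ (sym (lookup-index (mem p)))

  from∘to : ∀ i → from (to i) ≡ i
  from∘to i = lookup-injective (Unique.filter⁺ P? (words-unique n)) (from (to i)) i
                (sym (lookup-index (mem (to i))))

F₂-counts : ∀ n k → ¬ (n ≡ 0 × k ≡ 0) → Fin (F₂ n k) ↔ Σ Word (Reaches n k)
F₂-counts zero    zero    ≢0 = ⊥-elim (≢0 (refl , refl))
F₂-counts zero    (suc k) _  = wordsTo-counts zero (suc k)
F₂-counts (suc n) k       _  = wordsTo-counts (suc n) k

F₂-vanishes : ∀ {n k} → k > n → F₂ n k ≡ 0
F₂-vanishes {n} {k} k>n with F₂ n k in eq
... | zero  = refl
... | suc c = ⊥-elim (ℕ.<⇒≱ k>n (proj₂ (reaches-bounds (proj₁ p) (proj₂ p))))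
  where
  p : Σ Word (Reaches n k)
  p = Inverse.to
        (F₂-counts n k (λ { (refl , refl) → ℕ.n≮n 0 k>n }))
        (subst Fin (sym eq) zero)

-- In the coordinates y = k, d = n − k the maps become G : (y , d) ↦ (y , d + y)
-- and S : (y , d) ↦ (y + 2d + 1 , d), with start (1 , 0).  The words G^(n-1) and
-- S^(n-1) always reach row n, in columns 1 and n, so it suffices to reach row n in
-- some column strictly between.  Write n + 1 = 2^k (2o + 1).
-- If o ≥ 1, use S^c G S^(o-1) with c = 2^k − 1.  If o = 0, split on k mod 3:
--   k = 3i     : 7 ∣ n, use G^a S^6 with n = 7 (a + 1);
--   k = 3i + 1 : n ≡ 1 mod 7, use G^a S^2 G with n = 7 (a + 1) + 1;
--   k = 3i + 2 : n + 1 = 4h³ with h = 2^i, use G^(2h-2) S^(h+1) G^(h-1).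
module Submission where

open import Defs
open import Data.Empty using (⊥-elim)
open import Data.Fin using (zero; suc; toℕ)
open import Data.Fin.Properties using (nonZeroIndex)
open import Data.Integer as ℤ using (+_)
open import Data.Integer.Properties using (pos-*)
import Data.Integer.Tactic.RingSolver as ℤ
open import Data.List using ([]; _∷_; map; upTo; _∷ʳ_)
open import Data.List.Properties using (map-++; upTo-∷ʳ)
open import Data.Nat
open import Data.Nat.DivMod using (DivMod; _divMod_; result)
open import Data.Nat.Induction using (<-rec)
open import Data.Nat.ListAction using (sum)
open import Data.Nat.ListAction.Properties using (sum-++)
open import Data.Nat.Properties
open import Data.Nat.Tactic.RingSolver using (solve-∀)
open import Data.Product using (Σ; ∃; ∃₂; _,_)
open import Function using (module Inverse)
open import Relation.Binary.PropositionalEquality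

Reachable : ℕ → ℕ → Set
Reachable y d = Σ Word (Reaches (y + d) y)

start : Reachable 1 0
start = [] , refl

G-step : ∀ {y d} → Reachable y d → Reachable y (d + y)
G-step {y} {d} (w , r) = G ∷ w , trans (cong ⟦ G ⟧ r) (cong (λ x → + x , + y) (+-assoc y d y))

S-step : ∀ {y d} → Reachable y d → Reachable (y + suc (2 * d)) d
S-step {y} {d} (w , r) = S ∷ w , trans (cong ⟦ S ⟧ r) (cong₂ _,_ x-eq y-eq)
  where
  -- `+_` commutes with sums by computation, but with products only through `pos-*`.
  2d : + (2 * d) ≡ + 2 ℤ.* + d
  2d = pos-* 2 d

  x-ring : ∀ y d → + 3 ℤ.* (y ℤ.+ d) ℤ.- + 2 ℤ.* y ℤ.+ + 1 ≡ y ℤ.+ (+ 1 ℤ.+ + 2 ℤ.* d) ℤ.+ d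
  x-ring = ℤ.solve-∀

  y-ring : ∀ y d → + 2 ℤ.* (y ℤ.+ d) ℤ.- y ℤ.+ + 1 ≡ y ℤ.+ (+ 1 ℤ.+ + 2 ℤ.* d)
  y-ring = ℤ.solve-∀

  x-eq : + 3 ℤ.* + (y + d) ℤ.- + 2 ℤ.* + y ℤ.+ + 1 ≡ + (y + suc (2 * d) + d)
  x-eq = trans (x-ring (+ y) (+ d)) (cong (λ z → + y ℤ.+ (+ 1 ℤ.+ z) ℤ.+ + d) (sym 2d))

  y-eq : + 2 ℤ.* + (y + d) ℤ.- + y ℤ.+ + 1 ≡ + (y + suc (2 * d))
  y-eq = trans (y-ring (+ y) (+ d)) (cong (λ z → + y ℤ.+ (+ 1 ℤ.+ z)) (sym 2d))

G-power : ∀ a {y d} → Reachable y d → Reachable y (d + a * y)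
G-power zero    {y} {d} r = subst (Reachable y) (sym (+-identityʳ d)) r
G-power (suc a) {y} {d} r = subst (Reachable y) (+-assoc d y (a * y)) (G-power a (G-step r))

S-power : ∀ b {y d} → Reachable y d → Reachable (y + b * suc (2 * d)) d
S-power zero    {y} {d} r = subst (λ z → Reachable z d) (sym (+-identityʳ y)) r
S-power (suc b) {y} {d} r =
  subst (λ z → Reachable z d) (+-assoc y (suc (2 * d)) (b * suc (2 * d))) (S-power b (S-step r))

diagonal : ∀ m → Reachable (suc m) 0
diagonal m = subst (λ z → Reachable (suc z) 0) (*-identityʳ m) (S-power m start)

Hits : ℕ → ℕ → Set
Hits n k = 1 ≤ F₂ n k

reachable⇒hits : ∀ {n y d} → 0 < n → y + d ≡ n → Reachable y d → Hits n y
reachable⇒hits {y = y} {d} 0<n refl r =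
  -- The counting bijection sends the word to an element of `Fin (F₂ (y + d) y)`, so that size is
  -- nonzero.
  >-nonZero⁻¹ _ {{nonZeroIndex (Inverse.from (F₂-counts (y + d) y λ (n≡0 , _) → <⇒≢ 0<n (sym n≡0)) r)}}

column-one : ∀ {n} → 0 < n → Hits n 1
column-one {suc m} 0<n = reachable⇒hits 0<n (cong suc (*-identityʳ m)) (G-power m start)

column-last : ∀ {n} → 0 < n → Hits n n
column-last {suc m} 0<n = reachable⇒hits 0<n (+-identityʳ (suc m)) (diagonal m)

record Interior (n : ℕ) : Set where
  constructor interior
  field
    {y} d     : ℕ
    1<y       : 1 < y
    0<d       : 0 < d
    y+d≡n     : y + d ≡ n
    reachable : Reachable y d

module _ (f : ℕ → ℕ) where

  private
    partial : ℕ → ℕ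
    partial m = sum (map f (upTo m))

  partial-suc : ∀ m → partial (suc m) ≡ partial m + f m
  partial-suc m = begin
    sum (map f (upTo (suc m)))      ≡⟨ cong (λ xs → sum (map f xs)) (upTo-∷ʳ m) ⟨
    sum (map f (upTo m ∷ʳ m))       ≡⟨ cong sum (map-++ f (upTo m) (m ∷ [])) ⟩
    sum (map f (upTo m) ∷ʳ f m)     ≡⟨ sum-++ (map f (upTo m)) (f m ∷ []) ⟩
    partial m + (f m + 0)           ≡⟨ cong (λ s → partial m + s) (+-identityʳ (f m)) ⟩
    partial m + f m                 ∎
    where open ≡-Reasoning

  partial-mono : ∀ {k m} → k ≤′ m → partial k ≤ partial m
  partial-mono ≤′-refl = ≤-refl
  partial-mono {m = suc m} (≤′-step k≤m) = ≤-trans (partial-mono k≤m)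
    (≤-trans (m≤m+n (partial m) (f m)) (≤-reflexive (sym (partial-suc m))))

  -- Turns a positive entry into a strict jump of the partial sums, so that positive entries at
  -- increasing columns are counted by chaining inequalities.
  partial-< : ∀ {k m} → k < m → 1 ≤ f k → partial k < partial m
  partial-< {k} {m} k<m 1≤fk = begin-strict
    partial k         <⟨ m<m+n (partial k) 1≤fk ⟩
    partial k + f k   ≡⟨ partial-suc k ⟨
    partial (suc k)   ≤⟨ partial-mono (≤⇒≤′ k<m) ⟩
    partial m         ∎
    where open ≤-Reasoning

interior⇒F≥3 : ∀ {n} → Interior n → 3 ≤ F n
interior⇒F≥3 {n} (interior {y} d 1<y 0<d y+d≡n r) =
  -- The chain is 0 ≤ `partial 1` < `partial y` < `partial n` < `partial (suc n)`, the last being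
  -- `F n`; each strict step raises the lower bound by one.
  ≤-<-trans
    (≤-<-trans
      (≤-<-trans z≤n (partial-< (F₂ n) 1<y (column-one 0<n)))
      (partial-< (F₂ n) y<n (reachable⇒hits 0<n y+d≡n r)))
    (partial-< (F₂ n) (n<1+n n) (column-last 0<n))
  where
  y<n : y < n
  y<n = subst (y <_) y+d≡n (m<m+n y 0<d)
  0<n : 0 < n
  0<n = ≤-<-trans z≤n y<n

odd-part : ∀ m → 0 < m → ∃₂ λ k o → m ≡ 2 ^ k * suc (2 * o)
odd-part = <-rec _ (λ m rec 0<m → halve m rec 0<m (m divMod 2))
  where
  halve : ∀ m → (∀ {j} → j < m → 0 < j → ∃₂ λ k o → j ≡ 2 ^ k * suc (2 * o)) →
          0 < m → DivMod m 2 → ∃₂ λ k o → m ≡ 2 ^ k * suc (2 * o)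
  halve _ _ _ (result q (suc zero) refl) = 0 , q , ring q
    where
    ring : ∀ q → 1 + q * 2 ≡ 1 * (1 + 2 * q)
    ring = solve-∀
  halve _ rec 0<m (result zero zero refl) = ⊥-elim (n≮n 0 0<m)
  halve _ rec 0<m (result (suc q) zero refl) with rec (s≤s (s≤s (m≤m*n q 2))) (s≤s z≤n)
  ... | k , o , eq = suc k , o , trans (cong (_* 2) eq) (ring (2 ^ k) (suc (2 * o)))
    where
    ring : ∀ p s → p * s * 2 ≡ 2 * p * s
    ring = solve-∀

-- Since 8 = 1 + 7, every power of 8 is 1 modulo 7.
8^-mod-7 : ∀ i → ∃ λ q → 8 ^ i ≡ suc (7 * q)
8^-mod-7 zero = 0 , refl
8^-mod-7 (suc i) with 8^-mod-7 i
... | q , eq = 8 * q + 1 , trans (cong (8 *_) eq) (ring q)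
  where
  ring : ∀ q → 8 * (1 + 7 * q) ≡ 1 + 7 * (8 * q + 1)
  ring = solve-∀

interior-odd : ∀ {n} c o → suc n ≡ suc c * suc (2 * suc o) → n > 7 → Interior n
interior-odd {n} c o eq n>7 =
  -- With e = `suc o`, `S^o` and then `G` lead to y = d = e; each further `S` adds 2e + 1 to y, so y
  -- + d + 1 = (c + 1)(2e + 1).
  interior (suc o) 1<y (s≤s z≤n) y+d≡n (S-power c (G-step (diagonal o)))
  where
  y = suc o + c * suc (2 * suc o)

  ring : ∀ c o → 1 + (1 + o + c * (1 + 2 * (1 + o)) + (1 + o)) ≡ (1 + c) * (1 + 2 * (1 + o))
  ring = solve-∀

  y+d≡n : y + suc o ≡ n
  y+d≡n = suc-injective (trans (ring c o) (sym eq))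

  1<y : 1 < y
  -- As `suc o` is a summand of y, y ≤ 1 would give d ≤ 1 and hence n ≤ 2.
  1<y = ≰⇒> λ y≤1 → <⇒≱ n>7 (≤-trans (≤-reflexive (sym y+d≡n))
    (≤-trans (+-mono-≤ y≤1 (≤-trans (m≤m+n (suc o) _) y≤1)) (m≤n+m 2 5)))

interior-7∣n : ∀ {n} q → n ≡ 7 * q → n > 7 → Interior n
interior-7∣n zero          refl ()
-- For n = 7 the word would be `S^6`, which ends with d = 0 in the last column, not an interior one.
interior-7∣n (suc zero)    refl n>7 = ⊥-elim (n≮n 7 n>7)
interior-7∣n (suc (suc a)) refl _   =
  interior (0 + suc a * 7) (s≤s (s≤s z≤n)) (s≤s z≤n) (ring a) (G-power (suc a) (diagonal 6))
  where
  ring : ∀ a → 7 + (1 + a) * 7 ≡ 7 * (2 + a)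
  ring = solve-∀

interior-n≡1-mod-7 : ∀ {n} q → n ≡ suc (7 * q) → n > 7 → Interior n
interior-n≡1-mod-7 zero    refl (s≤s ())
interior-n≡1-mod-7 (suc a) refl _ =
  -- `G` gives (y , d) = (1 , 1) and two `S` give (7 , 1), so each further `G` adds 7 to d.
  interior (1 + a * 7) (s≤s (s≤s z≤n)) (s≤s z≤n) (ring a) (G-power a (S-power 2 (G-step start)))
  where
  ring : ∀ a → 7 + (1 + a * 7) ≡ 1 + 7 * (1 + a)
  ring = solve-∀

interior-4h³ : ∀ {n} h → suc n ≡ 4 * (h * h * h) → n > 7 → Interior n
interior-4h³ zero          () _
interior-4h³ (suc zero)    refl (s≤s (s≤s (s≤s ())))
interior-4h³ {n} (suc (suc g)) eq _ =
  -- Put h = 2 + g. The inner two blocks give d = h - 1 and y = 1 + (h + 1)(2h - 1) = h(2h + 1). The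
  -- outer `G` block adds 2(h - 1)y to d, so the row is h - 1 + (2h - 1)y = h - 1 + h(4h² - 1) = 4h³
  -- - 1.
  interior _ 1<y (s≤s z≤n) (suc-injective (trans (ring g) (sym eq)))
    (G-power (2 * suc g) (S-power (3 + g) (G-power (suc g) start)))
  where
  1<y : 1 < 1 + (3 + g) * suc (2 * (0 + suc g * 1))
  1<y = s≤s (s≤s z≤n)

  ring : ∀ g → let y = 1 + (3 + g) * (1 + 2 * (0 + (1 + g) * 1)) in
         1 + (y + (0 + (1 + g) * 1 + 2 * (1 + g) * y)) ≡ 4 * ((2 + g) * (2 + g) * (2 + g))
  ring = solve-∀

interior-2^ : ∀ {n} k → suc n ≡ 2 ^ k → n > 7 → Interior n
interior-2^ {n} k eq with k divMod 3
... | result i r refl = by-residue r (trans eq (2^-split r))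
  where
  2^-split : ∀ r → 2 ^ (toℕ r + i * 3) ≡ 2 ^ toℕ r * 8 ^ i
  2^-split r = begin
    2 ^ (toℕ r + i * 3)      ≡⟨ ^-distribˡ-+-* 2 (toℕ r) (i * 3) ⟩
    2 ^ toℕ r * 2 ^ (i * 3)  ≡⟨ cong (λ e → 2 ^ toℕ r * 2 ^ e) (*-comm i 3) ⟩
    2 ^ toℕ r * 2 ^ (3 * i)  ≡⟨ cong (2 ^ toℕ r *_) (^-*-assoc 2 3 i) ⟨
    2 ^ toℕ r * 8 ^ i        ∎
    where open ≡-Reasoning

  8^-cube : ∀ i → 8 ^ i ≡ 2 ^ i * 2 ^ i * 2 ^ i
  8^-cube zero    = refl
  8^-cube (suc i) = trans (cong (8 *_) (8^-cube i)) (ring (2 ^ i))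
    where
    ring : ∀ p → 8 * (p * p * p) ≡ 2 * p * (2 * p) * (2 * p)
    ring = solve-∀

  by-residue : ∀ r → suc n ≡ 2 ^ toℕ r * 8 ^ i → n > 7 → Interior n
  by-residue zero eq with 8^-mod-7 i
  ... | q , 8^ = interior-7∣n q (suc-injective (trans eq (trans (*-identityˡ _) 8^)))
  by-residue (suc zero) eq with 8^-mod-7 i
  -- Here n = 2(1 + 7q) - 1 = 1 + 7(2q).
  ... | q , 8^ = interior-n≡1-mod-7 (2 * q) (suc-injective (trans eq (trans (cong (2 *_) 8^) (ring q))))
    where
    ring : ∀ q → 2 * (1 + 7 * q) ≡ 2 + 7 * (2 * q)
    ring = solve-∀
  by-residue (suc (suc zero)) eq = interior-4h³ (2 ^ i) (trans eq (cong (4 *_) (8^-cube i)))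

interior-row : ∀ n → n > 7 → Interior n
interior-row n n>7 with odd-part (suc n) (s≤s z≤n)
... | k , zero  , eq = interior-2^ k (trans eq (*-identityʳ (2 ^ k))) n>7
-- The exponent c is 2^k - 1; truncation in `pred` is harmless because 2^k is nonzero.
... | k , suc o , eq = interior-odd (pred (2 ^ k)) o (trans eq (cong (_* suc (2 * suc o)) (sym 1+pred))) n>7
  where
  1+pred : suc (pred (2 ^ k)) ≡ 2 ^ k
  1+pred = suc-pred (2 ^ k) {{m^n≢0 2 k}}

theorem12 : (n : ℕ) → n > 7 → F n ≥ 3
theorem12 n n>7 = interior⇒F≥3 (interior-row n n>7)
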